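{- For every finite, simple, undirected, connected bipartite graph $G$, we have $cc(G) \le c(G)+2$, where $c(G)$ is the cop number of $G$ (in the ordinary game of Cops and Robbers) and $cc(G)$ is the minimum number of cops that have a winning strategy in the game of Cops and Attacking Robbers on $G$.
   Context: All graphs are finite, connected, simple and undirected. Cops and Robbers: the game is played on a graph $G$ with full information by two players, one controlling a set of cops and the other a single robber. The cops first choose initial vertices (several cops may occupy the same vertex), and then the robber chooses an initial vertex. After that the cops and the robber move alternately, with the cops moving first. On the cops' turn each cop either moves to a neighbouring vertex or stays where she is (any subset of the cops may move). On the robber's turn he either moves to a neighbouring vertex or stays where he is. The cops win if after finitely many rounds some cop occupies the same vertex as the robber (a capture); the robber wins if he can avoid capture indefinitely. The cop number $c(G)$ is the minimum number of cops for which the cops have a winning strategy on $G$. Cops and Attacking Robbers: the rules are the same, except that on his turn the robber may attack a cop: if he moves to a neighbouring vertex on which a cop is present, one cop on that vertex is eliminated (removed from the game). If that vertex contains exactly one cop, she is removed, the robber is not captured by this move, and the game continues with the remaining cops. If it contains two or more cops, only one of them is eliminated, and a remaining cop on that vertex then captures the robber, so the cops win. The robber may not start the game on a vertex occupied by a cop. The parameter $cc(G)$ is the minimum number of cops for which the cops have a winning strategy on $G$ in this game. -}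

module Defs where

open import Data.Bool.Base using (Bool)
open import Data.Fin.Base using (Fin)
open import Data.Nat.Base using (ℕ; suc; pred; _≤_; NonZero)
open import Data.Product.Base using (_×_; ∃)
open import Data.Vec.Functional using (Vector; removeAt)
open import Data.Vec.Functional.Relation.Binary.Pointwise using (Pointwise)
open import Data.Vec.Functional.Relation.Unary.Any using (Any)
open import Level using (0ℓ)
open import Relation.Binary.Construct.Closure.Reflexive using (ReflClosure)
open import Relation.Binary.Construct.Closure.ReflexiveTransitive using (Star)
open import Relation.Binary.Core using (Rel)
open import Relation.Binary.Definitions using (Decidable; Irreflexive; Symmetric)
open import Relation.Binary.PropositionalEquality.Core using (_≡_; _≢_)
open import Relation.Nullary.Negation.Core using (¬_)
open import Relation.Unary using (Pred)

record Graph : Set₁ where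
  field
    order      : ℕ
    Adj        : Rel (Fin order) 0ℓ
    adj?       : Decidable Adj
    adj-sym    : Symmetric Adj
    adj-irrefl : Irreflexive _≡_ Adj

  Vertex : Set
  Vertex = Fin order

  Step : Rel Vertex 0ℓ
  Step = ReflClosure Adj

module _ (G : Graph) where
  open Graph G

  Connected : Set
  Connected = NonZero order × (∀ u v → Star Adj u v)

  Bipartite : Set
  Bipartite = ∃ λ (side : Vertex → Bool) → ∀ {u v} → Adj u v → side u ≢ side v

  Occupied : ∀ {k} → Vector Vertex k → Pred Vertex 0ℓ
  Occupied C v = Any (_≡ v) C

-- In both games, an element of `CopsTurn C r` (`RobberTurn C r`) is a winning
-- strategy for the cops when they stand at C, the robber stands at r, and the
-- cops (the robber) are next to move.  It is a strategy tree: it prescribes a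
-- cop move after every sequence of robber moves.  The types are inductive, so
-- every play following the strategy reaches a capture after finitely many rounds.

module CopsAndRobbers (G : Graph) where
  open Graph G

  mutual
    data CopsTurn {k} (C : Vector Vertex k) (r : Vertex) : Set where
      captured : Occupied G C r → CopsTurn C r
      move     : ∀ C′ → Pointwise Step C C′ → RobberTurn C′ r → CopsTurn C r

    data RobberTurn {k} (C : Vector Vertex k) (r : Vertex) : Set where
      captured : Occupied G C r → RobberTurn C r
      reply    : (∀ r′ → Step r r′ → CopsTurn C r′) → RobberTurn C r

  CopsWin : Pred ℕ 0ℓ
  CopsWin k = ∃ λ (C : Vector Vertex k) → ∀ r → CopsTurn C r

module CopsAndAttackingRobbers (G : Graph) where
  open Graph G

  eliminate : ∀ {k} → Vector Vertex k → Fin k → Vector Vertex (pred k)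
  eliminate {suc _} C i = removeAt C i

  -- `RobberMove C r C′ r′`: the robber may go from r to r′, and doing so leaves
  -- the cops C′.  When several cops share the attacked vertex, any one of them
  -- may be the one eliminated; another one is then still at r′, so that
  -- `CopsTurn.captured` applies after the attack.
  data RobberMove {k} (C : Vector Vertex k) (r : Vertex) :
                  ∀ {m} → Vector Vertex m → Vertex → Set where
    quiet  : ∀ {r′} → Step r r′ → ¬ Occupied G C r′ → RobberMove C r C r′
    attack : ∀ i → Adj r (C i) → RobberMove C r (eliminate C i) (C i)

  mutual
    data CopsTurn {k} (C : Vector Vertex k) (r : Vertex) : Set where
      captured : Occupied G C r → CopsTurn C r
      move     : ∀ C′ → Pointwise Step C C′ → RobberTurn C′ r → CopsTurn C r

    data RobberTurn {k} (C : Vector Vertex k) (r : Vertex) : Set where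
      captured : Occupied G C r → RobberTurn C r
      reply    : (∀ {m} {C′ : Vector Vertex m} {r′} →
                  RobberMove C r C′ r′ → CopsTurn C′ r′) → RobberTurn C r

  CopsWin : Pred ℕ 0ℓ
  CopsWin k = ∃ λ (C : Vector Vertex k) → ∀ r → ¬ Occupied G C r → CopsTurn C r

IsLeast : Pred ℕ 0ℓ → Pred ℕ 0ℓ
IsLeast P k = P k × (∀ {m} → P m → k ≤ m)

-- The parameters c(G) and cc(G) appear as the relations "c(G) = k" and "cc(G) = k".

IsCopNumber : Graph → Pred ℕ 0ℓ
IsCopNumber G = IsLeast (CopsAndRobbers.CopsWin G)

IsAttackingCopNumber : Graph → Pred ℕ 0ℓ
IsAttackingCopNumber G = IsLeast (CopsAndAttackingRobbers.CopsWin G)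

{-# OPTIONS --safe #-}

-- In a bipartite graph a robber cannot attack a cop standing on his own side, so
-- the cops want to be on the robber's side whenever he is to move.  While the
-- robber keeps moving, c cops can do this and still stay within distance one of
-- the cops of an imaginary ordinary game, played by a winning strategy: once an
-- imaginary cop captures the robber, her companion does too.  The imaginary game
-- stands still whenever the robber passes.  The remaining two cops share a vertex,
-- which makes them immune, and step towards the robber at each of his passes, so
-- that he can pass only finitely often in a row.
module Submission where

open import Data.Bool.Base using (Bool)
open import Data.Bool.Properties using (¬-not) renaming (_≟_ to _≟ᵇ_)
open import Data.Empty using (⊥-elim)
open import Data.Fin.Base using (zero; suc; fromℕ<)
open import Data.Nat.Base using (ℕ; _+_; _≤_; >-nonZero⁻¹)
open import Data.Nat.Properties using (+-comm)
open import Data.Product.Base using (∃; _×_; _,_; proj₁; proj₂)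
open import Data.Vec.Functional using (Vector; _∷_)
open import Data.Vec.Functional.Relation.Binary.Pointwise using (Pointwise)
open import Relation.Binary.Construct.Closure.Reflexive using (refl; [_])
open import Relation.Binary.Construct.Closure.ReflexiveTransitive using (Star; ε; _◅_)
open import Relation.Binary.PropositionalEquality
  using (_≡_; _≢_; refl; sym; trans; subst; ≢-sym)
open import Relation.Nullary using (yes; no)
open import Defs

≢-≢⇒≡ : ∀ {a b c : Bool} → a ≢ b → b ≢ c → a ≡ c
≢-≢⇒≡ a≢b b≢c = trans (¬-not a≢b) (sym (¬-not (≢-sym b≢c)))

module _ (G : Graph) (connected : Connected G) (bipartite : Bipartite G) where
  open Graph G
  private
    module CR = CopsAndRobbers G
    module CAR = CopsAndAttackingRobbers G

  side : Vertex → Bool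
  side = proj₁ bipartite

  adj⇒side≢ : ∀ {u v} → Adj u v → side u ≢ side v
  adj⇒side≢ = proj₂ bipartite

  path : ∀ u v → Star Adj u v
  path = proj₂ connected

  neighbour : ∀ {u v} → u ≢ v → ∃ (Adj u)
  neighbour {u} {v} u≢v with path u v
  ... | ε     = ⊥-elim (u≢v refl)
  ... | e ◅ _ = _ , e

  step∧side≡⇒≡ : ∀ {u v} → Step u v → side u ≡ side v → u ≡ v
  step∧side≡⇒≡ refl  _  = refl
  step∧side≡⇒≡ [ e ] eq = ⊥-elim (adj⇒side≢ e eq)

  -- A real cop at c accompanies an imaginary cop at v, the robber being at r and to move.
  record Guards (r v c : Vertex) : Set where
    constructor guards
    field
      near     : Step c v
      sameSide : side c ≡ side r

  -- Any neighbour of `c` mends a wrong side: `v` itself if adjacent, and if `c` is already `v`, any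
  -- vertex next to it.
  join : ∀ {r c v} → Step c v → ∃ λ d → Step c d × Guards r v d
  join {r} {c} s with side c ≟ᵇ side r
  join {r} {c} s     | yes eq = c , refl , guards s eq
  join {r} {c} [ e ] | no neq = _ , [ e ] , guards refl (≢-≢⇒≡ (≢-sym (adj⇒side≢ e)) neq)
  join {r} {c} refl  | no neq with neighbour {c} {r} (λ { refl → neq refl })
  ... | d , e = d , [ e ] , guards [ adj-sym e ] (≢-≢⇒≡ (≢-sym (adj⇒side≢ e)) neq)

  -- A companion on `v` is within one step of `v′`, so `join` applies. One adjacent to `v` moves
  -- there: `v` is opposite `c` as `r′` is opposite `r`, so the sides agree again.
  follow : ∀ {r r′ v v′ c} → Adj r r′ → Guards r v c → Step v v′ →
           ∃ λ d → Step c d × Guards r′ v′ d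
  follow a (guards refl eq)  t = join t
  follow a (guards [ e ] eq) t =
    _ , [ e ] , guards t (≢-≢⇒≡ (≢-sym (adj⇒side≢ e)) λ eq′ → adj⇒side≢ a (trans (sym eq) eq′))

  withPair : ∀ {k} → Vertex → Vector Vertex k → Vector Vertex (2 + k)
  withPair p C = p ∷ p ∷ C

  withPair⁺ : ∀ {k p q} {C D : Vector Vertex k} → Step p q → Pointwise Step C D →
              Pointwise Step (withPair p C) (withPair q D)
  withPair⁺ s ss zero          = s
  withPair⁺ s ss (suc zero)    = s
  withPair⁺ s ss (suc (suc i)) = ss i

  Guarding : ∀ {k} → Vertex → Vector Vertex k → Vector Vertex k → Set
  Guarding r V C = ∀ i → Guards r (V i) (C i)

  respond : ∀ {k m r r′ p q} {V C : Vector Vertex k} {C′ : Vector Vertex m} →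
            Adj p q → Guarding r V C → CAR.RobberTurn (withPair q C) r →
            (∀ {r′} → Adj r r′ → CAR.CopsTurn (withPair p C) r′) →
            CAR.RobberMove (withPair p C) r C′ r′ → CAR.CopsTurn C′ r′
  respond e g pass go (CAR.quiet refl _)        = CAR.move _ (withPair⁺ [ e ] λ _ → refl) pass
  respond e g pass go (CAR.quiet [ a ] _)       = go a
  -- The other cop of the pair still stands on the attacked vertex.
  respond e g pass go (CAR.attack zero _)       = CAR.captured (zero , refl)
  respond e g pass go (CAR.attack (suc zero) _) = CAR.captured (zero , refl)
  respond e g pass go (CAR.attack (suc (suc i)) a) =
    ⊥-elim (adj⇒side≢ a (sym (Guards.sameSide (g i))))

  mutual
    -- The recursion is lexicographic: a pass keeps the imaginary strategy tree and shortens the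
    -- pair's path; a move descends in the tree, and the path may then be chosen afresh.
    robberTurn : ∀ {k r p} {V C : Vector Vertex k} → CR.RobberTurn V r → Star Adj p r →
                 Guarding r V C → CAR.RobberTurn (withPair p C) r
    robberTurn (CR.captured (i , refl)) _ g =
      CAR.captured (suc (suc i) , step∧side≡⇒≡ (Guards.near (g i)) (Guards.sameSide (g i)))
    robberTurn (CR.reply f) ε g = CAR.captured (zero , refl)
    robberTurn t@(CR.reply f) (e ◅ es) g =
      CAR.reply (respond e g (robberTurn t es g) λ {r′} a → copsTurn (f r′ [ a ]) a g)

    copsTurn : ∀ {k r r′ p} {V C : Vector Vertex k} → CR.CopsTurn V r′ → Adj r r′ →
               Guarding r V C → CAR.CopsTurn (withPair p C) r′
    copsTurn (CR.captured (i , refl)) a g =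
      -- Each companion steps onto her imaginary cop, one of whom is at `r′`.
      CAR.move _ (withPair⁺ refl λ i → Guards.near (g i)) (CAR.captured (suc (suc i) , refl))
    copsTurn {r′ = r′} {p} (CR.move V′ ss t) a g =
      CAR.move _ (withPair⁺ refl λ i → proj₁ (proj₂ (followed i)))
        (robberTurn t (path p r′) λ i → proj₂ (proj₂ (followed i)))
      where
      followed = λ i → follow a (g i) (ss i)

  -- Real and imaginary cops start together. The robber chooses `r` only afterwards, so the sides
  -- are first arranged here, by `join`.
  start : ∀ {k r p} {V : Vector Vertex k} → CR.CopsTurn V r → CAR.CopsTurn (withPair p V) r
  start (CR.captured (i , eq)) = CAR.captured (suc (suc i) , eq)
  start {r = r} {p} (CR.move V′ ss t) =
    CAR.move _ (withPair⁺ refl λ i → proj₁ (proj₂ (joined i)))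
      (robberTurn t (path p r) λ i → proj₂ (proj₂ (joined i)))
    where
    joined = λ i → join (ss i)

  copsWin⇒attackingCopsWin : ∀ {k} → CR.CopsWin k → CAR.CopsWin (2 + k)
  copsWin⇒attackingCopsWin (V , win) =
    withPair (fromℕ< (>-nonZero⁻¹ order {{proj₁ connected}})) V , λ r _ → start (win r)

theorem9 : (G : Graph) → Connected G → Bipartite G →
    (c cc : ℕ) → IsCopNumber G c → IsAttackingCopNumber G cc →
    cc ≤ c + 2
theorem9 G connected bipartite c cc (win , _) (_ , least) =
  least (subst (CopsAndAttackingRobbers.CopsWin G) (+-comm 2 c)
    (copsWin⇒attackingCopsWin G connected bipartite win))
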